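{- A one-pass stream algorithm that tests whether $\min_{\mathcal C}\mathrm{disagree}(G,\mathcal C)=0$ (minimum over all partitions $\mathcal C$ of the node set), with probability at least $9/10$, for graphs $G$ on $n$ nodes, requires $\Omega(n^2)$ bits of space if permitted weights are $\{ -1,0,1\}$.
   Context: Correlation clustering: a weighted graph $G$ on a node set $V$ with $|V|=n$ assigns a weight $w_{uv}$ to each unordered pair $uv$ of distinct nodes (here each weight is in $\{ -1,0,1\}$; pairs not occurring in the stream have weight $0$ and are regarded as non-edges). A clustering is a partition $\mathcal C$ of $V$. A pair $uv$ disagrees with $\mathcal C$ if either $w_{uv}>0$ and $u,v$ are in different clusters, or $w_{uv}<0$ and $u,v$ are in the same cluster. $\mathrm{disagree}(G,\mathcal C)$ is the sum of $|w_{uv}|$ over pairs that disagree with $\mathcal C$. Streaming model: the input is a sequence of edges with their weights, in arbitrary order, read once. Algorithms may be randomized and must be correct with probability at least $9/10$ on every input. The space is the number of bits of memory used. -}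

module Defs where

open import Data.Bool using (Bool; true; false)
import Data.Bool.Properties as Bool
open import Data.Fin using (Fin; _<_)
open import Data.Fin.Properties using (_<?_)
open import Data.Integer using (ℤ; +_; 0ℤ; 1ℤ; -1ℤ; ∣_∣)
import Data.Integer as ℤ
import Data.Integer.Properties as ℤ
open import Data.List using (List; allFin; cartesianProduct; filter; foldl; length; map; mapMaybe)
open import Data.List.Membership.Propositional using (_∈_)
open import Data.List.Relation.Unary.Unique.Propositional using (Unique)
open import Data.Maybe using (Maybe)
import Data.Maybe as Maybe
open import Data.Nat using (ℕ; NonZero; _≤_)
open import Data.Nat.ListAction using (sum)
open import Data.Product using (_×_; _,_; ∃-syntax)
open import Data.Rational.Unnormalised using (ℚᵘ; _/_) renaming (_≤_ to _≤ᵘ_)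
open import Data.Sum using (_⊎_)
open import Data.Vec using (Vec)
open import Function using (_⇔_)
open import Level using (0ℓ)
open import Relation.Binary using (Rel; IsDecEquivalence)
open import Relation.Binary.PropositionalEquality using (_≡_; _≢_)
open import Relation.Nullary using (¬_; Dec)
open import Relation.Nullary.Decidable using (_×-dec_; _⊎-dec_; ¬?; dec⇒maybe)

-- An unordered pair of distinct nodes, represented by its increasing listing.
record Pair (n : ℕ) : Set where
  constructor pair
  field
    u v  : Fin n
    .u<v : u < v

allPairs : ∀ n → List (Pair n)
allPairs n = mapMaybe increasing (cartesianProduct (allFin n) (allFin n))
  where
  increasing : Fin n × Fin n → Maybe (Pair n)
  increasing (u , v) = Maybe.map (λ u<v → pair u v u<v) (dec⇒maybe (u <? v))

data Weight : Set where
  -1ʷ 0ʷ +1ʷ : Weight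

⟦_⟧ : Weight → ℤ
⟦ -1ʷ ⟧ = -1ℤ
⟦ 0ʷ  ⟧ = 0ℤ
⟦ +1ʷ ⟧ = 1ℤ

WeightedGraph : ℕ → Set
WeightedGraph n = Pair n → Weight

-- A partition of the node set, given by its "same cluster" relation.
record Clustering (n : ℕ) : Set₁ where
  field
    _~_              : Rel (Fin n) 0ℓ
    isDecEquivalence : IsDecEquivalence _~_

  open IsDecEquivalence isDecEquivalence public using () renaming (_≟_ to _~?_)

module _ {n : ℕ} (G : WeightedGraph n) where

  Disagrees : Clustering n → Pair n → Set
  Disagrees C e@(pair u v _) =
    (0ℤ ℤ.< ⟦ G e ⟧ × ¬ (u ~ v)) ⊎ (⟦ G e ⟧ ℤ.< 0ℤ × u ~ v)
    where open Clustering C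

  disagrees? : ∀ C e → Dec (Disagrees C e)
  disagrees? C e@(pair u v _) =
    ((0ℤ ℤ.<? ⟦ G e ⟧) ×-dec ¬? (u ~? v)) ⊎-dec ((⟦ G e ⟧ ℤ.<? 0ℤ) ×-dec (u ~? v))
    where open Clustering C

  disagree : Clustering n → ℕ
  disagree C = sum (map (λ e → ∣ ⟦ G e ⟧ ∣) (filter (disagrees? C) (allPairs n)))

  MinDisagreeIs : ℕ → Set₁
  MinDisagreeIs m = (∃[ C ] disagree C ≡ m) × (∀ C → m ≤ disagree C)

Token : ℕ → Set
Token n = Pair n × Weight

Stream : ℕ → Set
Stream n = List (Token n)

-- The stream lists, in any order, every edge of G exactly once with its weight;
-- pairs of weight 0 are not edges and do not occur.
_IsStreamOf_ : ∀ {n} → Stream n → WeightedGraph n → Set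
σ IsStreamOf G = Unique σ × (∀ e w → (e , w) ∈ σ ⇔ (G e ≡ w × w ≢ 0ʷ))

-- One-pass algorithms whose whole memory between tokens is `space` bits.  All
-- random choices are made by a seed, uniform on a finite set, which may be read
-- at any time and is not charged to the memory.  Coins tossed afresh at each
-- token are covered: no pair occurs twice in a stream, so a seed can hold
-- independent coins for each possible token.  Finite uniform seeds lose no
-- generality: for fixed n and space there are finitely many deterministic
-- algorithms, and the linear constraints with rational coefficients imposed by
-- TestsMinDisagreeZero on a distribution over them have a rational solution if
-- they have a real one.
record StreamAlgorithm (n space : ℕ) : Set where
  Memory : Set
  Memory = Vec Bool space

  field
    seeds             : ℕ
    ⦃ seeds-nonZero ⦄ : NonZero seeds
    init              : Fin seeds → Memory
    step              : Fin seeds → Memory → Token n → Memory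
    output            : Fin seeds → Memory → Bool

  run : Fin seeds → Stream n → Bool
  run ω σ = output ω (foldl (step ω) (init ω) σ)

  Pr[run_≡_] : Stream n → Bool → ℚᵘ
  Pr[run σ ≡ b ] = + length (filter (λ ω → run ω σ Bool.≟ b) (allFin seeds)) / seeds

TestsMinDisagreeZero : ∀ {n space} → StreamAlgorithm n space → Set₁
TestsMinDisagreeZero {n} A =
  ∀ (G : WeightedGraph n) (σ : Stream n) → σ IsStreamOf G →
    (MinDisagreeIs G 0   → + 9 / 10 ≤ᵘ Pr[run σ ≡ true ]) ×
    (¬ MinDisagreeIs G 0 → + 9 / 10 ≤ᵘ Pr[run σ ≡ false ])
  where open StreamAlgorithm A

{-# OPTIONS --safe #-}
-- Reduction from the one-way communication problem INDEX.  Fix quadratically many pairs of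
-- nodes ("slots") avoiding a hub node.  Alice encodes a bit string x by streaming a
-- negative edge on each slot whose bit is false; Bob, who wants the bit of the slot uv,
-- appends positive edges from the hub to u and to v.  A disagreement-free clustering must
-- then put u and v together, so it exists iff uv is not a negative edge (let the hub, u and
-- v form the only nontrivial cluster).  The memory after Alice's part is thus a message
-- from which every single bit can be decoded with probability 9/10.
--
-- To bound its length, let N be the number of slots and a(x) the number of coordinates in
-- which x agrees with the string decoded from its message.  Each fixed string y has
-- Σₓ 2^agree(x,y) = 3^N, so summing over all messages Σₓ 2^a(x) ≤ 2^s 3^N, whereas a(x)
-- averages 9N/10 over the seeds and hence Σₓ E 2^a(x) ≥ 2^N 2^(9N/10) by convexity.  As
-- 3^10 < 2^16 this forces s ≥ 3N/10.
module Submission where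

open import Defs
open import Data.Nat using (ℕ; _≤_; _^_)
open import Data.Integer using (+_)
open import Data.Product using (_×_; ∃-syntax)
open import Data.Rational.Unnormalised using (0ℚᵘ; _/_) renaming (_*_ to _*ᵘ_; _≤_ to _≤ᵘ_; _<_ to _<ᵘ_)
open import Data.Bool using (Bool; true; false)
import Data.Bool.Properties as Bool
open import Data.Fin using (Fin; zero; suc; inject≤; _↑ˡ_; _↑ʳ_; remQuot; combine; toℕ)
import Data.Fin as Fin
import Data.Fin.Properties as Fin
open import Data.Integer using (0ℤ; ∣_∣; +≤+; +<+; -<+)
import Data.Integer as ℤ
import Data.Integer.Properties as ℤ
open import Data.List using (List; []; _∷_; _++_; allFin; filter; foldl; length; map)
open import Data.List.Properties using (filter-none; foldl-++; length-++; length-map; length-tabulate; map-++; map-cong; map-tabulate; map-∘)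
open import Data.List.Membership.Propositional using (_∈_; lose)
open import Data.List.Membership.Propositional.Properties using (∈-map⁺; ∈-map⁻; ∈-++⁺ˡ; ∈-++⁺ʳ; ∈-++⁻; ∈-filter⁺; ∈-filter⁻; ∈-allFin; ∈-cartesianProduct⁺)
open import Data.List.Relation.Unary.All using (All; []; _∷_)
import Data.List.Relation.Unary.All as All
import Data.List.Relation.Unary.All.Properties as All
open import Data.List.Relation.Unary.Any using (here; there)
import Data.List.Relation.Unary.Any.Properties as Any
open import Data.List.Relation.Unary.Unique.Propositional using (Unique; []; _∷_)
import Data.List.Relation.Unary.Unique.Propositional.Properties as Unique
import Data.Maybe as Maybe
import Data.Maybe.Relation.Unary.Any as MAny
open import Data.Nat using (zero; suc; NonZero; _<_; _+_; _*_; z≤n; s≤s; z<s; s<s; s≤s⁻¹)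
import Data.Nat as ℕ
open import Data.Nat.DivMod using (m≡m%n+[m/n]*n; m%n<n; m/n*n≤m; m≥n⇒m/n>0)
open import Data.Nat.ListAction using (sum)
open import Data.Nat.ListAction.Properties using (sum-++)
open import Data.Nat.Properties
open import Data.Nat.Tactic.RingSolver using (solve-∀)
open import Data.Product using (_,_; proj₁; proj₂; uncurry)
open import Data.Rational.Unnormalised using (*≤*; *<*)
open import Data.Rational.Unnormalised.Properties using (drop-*≤*)
open import Data.Sum using (_⊎_; inj₁; inj₂)
open import Data.Vec using (Vec; []; _∷_; lookup)
open import Function using (_∘_; _⇔_; mk⇔; Equivalence)
open import Function.Definitions using (Injective)
open import Relation.Binary using (IsDecEquivalence)
import Relation.Binary.Construct.On as On
open import Relation.Binary.PropositionalEquality using (_≡_; _≢_; _≗_; refl; sym; trans; cong; cong₂; subst; subst₂; module ≡-Reasoning)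
import Relation.Binary.PropositionalEquality.Properties as ≡
open import Relation.Nullary using (¬_; Dec; yes; no; contradiction; contradiction-irr)
open import Relation.Nullary.Decidable using (decidable-stable; dec⇒maybe; map′; _×-dec_; _⊎-dec_)
open import Relation.Unary using (Pred; Decidable)

private variable
  A B : Set
  n : ℕ

-- Sums over lists and indicators.

∑ : List A → (A → ℕ) → ℕ
∑ xs f = sum (map f xs)

infix 10 ∑
syntax ∑ xs (λ x → e) = ∑[ x ← xs ] e

∑-cong : ∀ (xs : List A) {f g} → f ≗ g → ∑ xs f ≡ ∑ xs g
∑-cong xs f≗g = cong sum (map-cong f≗g xs)

∑-mono-≤ : ∀ (xs : List A) {f g} → (∀ x → f x ≤ g x) → ∑ xs f ≤ ∑ xs g
∑-mono-≤ []       f≤g = z≤n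
∑-mono-≤ (x ∷ xs) f≤g = +-mono-≤ (f≤g x) (∑-mono-≤ xs f≤g)

∑-const : ∀ (xs : List A) c → ∑[ _ ← xs ] c ≡ length xs * c
∑-const []       c = refl
∑-const (x ∷ xs) c = cong (_+_ c) (∑-const xs c)

∑-distrib-+ : ∀ (xs : List A) f g → ∑[ x ← xs ] (f x + g x) ≡ ∑ xs f + ∑ xs g
∑-distrib-+ []       f g = refl
∑-distrib-+ (x ∷ xs) f g = begin
  f x + g x + ∑ xs (λ y → f y + g y) ≡⟨ cong (_+_ (f x + g x)) (∑-distrib-+ xs f g) ⟩
  f x + g x + (∑ xs f + ∑ xs g)      ≡⟨ interchange (f x) (g x) (∑ xs f) (∑ xs g) ⟩
  f x + ∑ xs f + (g x + ∑ xs g)      ∎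
  where
  open ≡-Reasoning
  interchange : ∀ a b c d → a + b + (c + d) ≡ a + c + (b + d)
  interchange = solve-∀

*-distribˡ-∑ : ∀ (xs : List A) c f → c * ∑ xs f ≡ ∑[ x ← xs ] (c * f x)
*-distribˡ-∑ []       c f = *-zeroʳ c
*-distribˡ-∑ (x ∷ xs) c f =
  trans (*-distribˡ-+ c (f x) (∑ xs f)) (cong (_+_ (c * f x)) (*-distribˡ-∑ xs c f))

∑-comm : ∀ (xs : List A) (ys : List B) (f : A → B → ℕ) →
         ∑[ x ← xs ] ∑[ y ← ys ] f x y ≡ ∑[ y ← ys ] ∑[ x ← xs ] f x y
∑-comm []       ys f = sym (trans (∑-const ys 0) (*-zeroʳ (length ys)))
∑-comm (x ∷ xs) ys f = begin
  ∑ ys (f x) + ∑[ x ← xs ] ∑ ys (f x)        ≡⟨ cong (_+_ (∑ ys (f x))) (∑-comm xs ys f) ⟩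
  ∑ ys (f x) + ∑[ y ← ys ] ∑[ x ← xs ] f x y ≡⟨ ∑-distrib-+ ys (f x) _ ⟨
  ∑[ y ← ys ] (f x y + ∑[ x ← xs ] f x y)    ∎
  where open ≡-Reasoning

∑-++ : ∀ (xs ys : List A) f → ∑ (xs ++ ys) f ≡ ∑ xs f + ∑ ys f
∑-++ xs ys f = trans (cong sum (map-++ f xs ys)) (sum-++ (map f xs) (map f ys))

∑-map : ∀ (g : A → B) xs f → ∑ (map g xs) f ≡ ∑[ x ← xs ] f (g x)
∑-map g xs f = cong sum (sym (map-∘ xs))

∑-allFin-suc : ∀ {n} (f : Fin (suc n) → ℕ) → ∑ (allFin (suc n)) f ≡ f zero + ∑[ i ← allFin n ] f (suc i)
∑-allFin-suc f = cong (λ fs → f zero + sum fs) (trans (map-tabulate suc f) (sym (map-tabulate _ (f ∘ suc))))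

∈⇒≤∑ : ∀ {xs : List A} {x} f → x ∈ xs → f x ≤ ∑ xs f
∈⇒≤∑ {xs = x ∷ xs} f (here refl)  = m≤m+n (f x) (∑ xs f)
∈⇒≤∑ {xs = y ∷ xs} f (there x∈xs) = ≤-trans (∈⇒≤∑ f x∈xs) (m≤n+m (∑ xs f) (f y))

ind : ∀ {P : Set} → Dec P → ℕ
ind (yes _) = 1
ind (no  _) = 0

length-filter-∑ : ∀ {P : Pred A _} (P? : Decidable P) xs → length (filter P? xs) ≡ ∑[ x ← xs ] ind (P? x)
length-filter-∑ P? []       = refl
length-filter-∑ P? (x ∷ xs) with P? x
... | yes _ = cong suc (length-filter-∑ P? xs)
... | no  _ = length-filter-∑ P? xs

-- The Boolean cube and agreement counts.

cube : ∀ n → List (Vec Bool n)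
cube zero    = [] ∷ []
cube (suc n) = map (true ∷_) (cube n) ++ map (false ∷_) (cube n)

∈-cube : ∀ {n} (x : Vec Bool n) → x ∈ cube n
∈-cube []          = here refl
∈-cube (true  ∷ x) = ∈-++⁺ˡ (∈-map⁺ _ (∈-cube x))
∈-cube (false ∷ x) = ∈-++⁺ʳ _ (∈-map⁺ _ (∈-cube x))

length-cube : ∀ n → length (cube n) ≡ 2 ^ n
length-cube zero    = refl
length-cube (suc n) = begin
  length (map (true ∷_) (cube n) ++ map (false ∷_) (cube n))
    ≡⟨ length-++ (map (true ∷_) (cube n)) ⟩
  length (map (true ∷_) (cube n)) + length (map (false ∷_) (cube n))
    ≡⟨ cong₂ _+_ (length-map _ (cube n)) (length-map _ (cube n)) ⟩
  length (cube n) + length (cube n)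
    ≡⟨ cong₂ _+_ (length-cube n) (trans (length-cube n) (sym (+-identityʳ (2 ^ n)))) ⟩
  2 ^ suc n ∎
  where open ≡-Reasoning

agree : ∀ {n} → Vec Bool n → (Fin n → Bool) → ℕ
agree {n} x y = ∑[ i ← allFin n ] ind (y i Bool.≟ lookup x i)

-- The sum factors over the coordinates: in each one the bit equal to that of `y` contributes 2 and
-- the other bit contributes 1.
∑-2^agree : ∀ {n} (y : Fin n → Bool) → ∑[ x ← cube n ] (2 ^ agree x y) ≡ 3 ^ n
∑-2^agree {zero}  y = refl
∑-2^agree {suc n} y = begin
  ∑[ x ← cube (suc n) ] (2 ^ agree x y)
    ≡⟨ ∑-++ (map (true ∷_) (cube n)) _ _ ⟩
  ∑[ x ← map (true ∷_) (cube n) ] (2 ^ agree x y) + ∑[ x ← map (false ∷_) (cube n) ] (2 ^ agree x y)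
    ≡⟨ cong₂ _+_ (head true) (head false) ⟩
  2 ^ ind (y zero Bool.≟ true) * 3 ^ n + 2 ^ ind (y zero Bool.≟ false) * 3 ^ n
    ≡⟨ one-agrees (y zero) ⟩
  3 ^ suc n ∎
  where
  open ≡-Reasoning
  head : ∀ b → ∑[ x ← map (b ∷_) (cube n) ] (2 ^ agree x y) ≡ 2 ^ ind (y zero Bool.≟ b) * 3 ^ n
  head b = begin
    ∑[ x ← map (b ∷_) (cube n) ] (2 ^ agree x y)
      ≡⟨ ∑-map (b ∷_) (cube n) _ ⟩
    ∑[ x ← cube n ] (2 ^ agree (b ∷ x) y)
      ≡⟨ ∑-cong (cube n) (λ x → trans (cong (2 ^_) (∑-allFin-suc (λ i → ind (y i Bool.≟ lookup (b ∷ x) i))))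
           (^-distribˡ-+-* 2 (ind (y zero Bool.≟ b)) (agree x (y ∘ suc)))) ⟩
    ∑[ x ← cube n ] (2 ^ ind (y zero Bool.≟ b) * 2 ^ agree x (y ∘ suc))
      ≡⟨ *-distribˡ-∑ (cube n) (2 ^ ind (y zero Bool.≟ b)) _ ⟨
    2 ^ ind (y zero Bool.≟ b) * ∑[ x ← cube n ] (2 ^ agree x (y ∘ suc))
      ≡⟨ cong (2 ^ ind (y zero Bool.≟ b) *_) (∑-2^agree (y ∘ suc)) ⟩
    2 ^ ind (y zero Bool.≟ b) * 3 ^ n ∎
  twice-plus : ∀ t → 2 * t + 1 * t ≡ 3 * t
  twice-plus = solve-∀
  plus-twice : ∀ t → 1 * t + 2 * t ≡ 3 * t
  plus-twice = solve-∀
  one-agrees : ∀ b → 2 ^ ind (b Bool.≟ true) * 3 ^ n + 2 ^ ind (b Bool.≟ false) * 3 ^ n ≡ 3 * 3 ^ n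
  one-agrees true  = twice-plus (3 ^ n)
  one-agrees false = plus-twice (3 ^ n)

-- Convexity of powers of two.

1+n≤2^n : ∀ n → 1 + n ≤ 2 ^ n
1+n≤2^n zero    = s≤s z≤n
1+n≤2^n (suc n) = begin
  1 + suc n     ≤⟨ +-mono-≤ (m^n>0 2 n) (1+n≤2^n n) ⟩
  2 ^ n + 2 ^ n ≡⟨ cong (_+_ (2 ^ n)) (+-identityʳ (2 ^ n)) ⟨
  2 ^ suc n     ∎
  where open ≤-Reasoning

-- The line through (b , 2^b) and (b + 1 , 2^(b+1)) lies below the graph of 2^a at every
-- integer a; the term 2^b b is moved to the right so that no subtraction occurs.
2^-chord : ∀ a b → 2 ^ b * (1 + a) ≤ 2 ^ a + 2 ^ b * b
2^-chord zero    zero    = ≤-refl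
2^-chord zero    (suc b) = ≤-trans (*-monoʳ-≤ (2 ^ suc b) (s≤s z≤n)) (m≤n+m _ 1)
2^-chord (suc a) zero    = begin
  1 * (1 + suc a)   ≡⟨ *-identityˡ (1 + suc a) ⟩
  1 + suc a         ≤⟨ 1+n≤2^n (suc a) ⟩
  2 ^ suc a         ≤⟨ m≤m+n _ _ ⟩
  2 ^ suc a + 1 * 0 ∎
  where open ≤-Reasoning
2^-chord (suc a) (suc b) = begin
  2 * 2 ^ b * (1 + suc a)             ≡⟨ regroup (2 ^ b) a ⟩
  2 * (2 ^ b * (1 + a)) + 2 * 2 ^ b   ≤⟨ +-monoˡ-≤ (2 * 2 ^ b) (*-monoʳ-≤ 2 (2^-chord a b)) ⟩
  2 * (2 ^ a + 2 ^ b * b) + 2 * 2 ^ b ≡⟨ regroup′ (2 ^ a) (2 ^ b) b ⟩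
  2 * 2 ^ a + 2 * 2 ^ b * suc b       ∎
  where
  open ≤-Reasoning
  regroup : ∀ t a → 2 * t * (1 + suc a) ≡ 2 * (t * (1 + a)) + 2 * t
  regroup = solve-∀
  regroup′ : ∀ s t b → 2 * (s + t * b) + 2 * t ≡ 2 * s + 2 * t * suc b
  regroup′ = solve-∀

-- Sum the chord inequality at the integer `b` over `xs`. The hypothesis `mean` bounds the linear
-- part from below, and `2 ^ b * (l * b)`, then present on both sides, cancels.
jensen-2^ : ∀ (xs : List A) f b → length xs * b ≤ ∑ xs f → length xs * 2 ^ b ≤ ∑[ x ← xs ] (2 ^ f x)
jensen-2^ xs f b mean = +-cancelʳ-≤ (2 ^ b * (l * b)) _ _ (begin
  l * 2 ^ b + 2 ^ b * (l * b)      ≡⟨ cong (_+ 2 ^ b * (l * b)) (*-comm l (2 ^ b)) ⟩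
  2 ^ b * l + 2 ^ b * (l * b)      ≤⟨ +-monoʳ-≤ (2 ^ b * l) (*-monoʳ-≤ (2 ^ b) mean) ⟩
  2 ^ b * l + 2 ^ b * ∑ xs f       ≡⟨ *-distribˡ-+ (2 ^ b) l (∑ xs f) ⟨
  2 ^ b * (l + ∑ xs f)             ≡⟨ cong (λ c → 2 ^ b * (c + ∑ xs f)) (trans (∑-const xs 1) (*-identityʳ l)) ⟨
  2 ^ b * (∑[ _ ← xs ] 1 + ∑ xs f) ≡⟨ cong (2 ^ b *_) (∑-distrib-+ xs (λ _ → 1) f) ⟨
  2 ^ b * ∑[ x ← xs ] (1 + f x)    ≡⟨ *-distribˡ-∑ xs (2 ^ b) _ ⟩
  ∑[ x ← xs ] (2 ^ b * (1 + f x))  ≤⟨ ∑-mono-≤ xs (λ x → 2^-chord (f x) b) ⟩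
  ∑[ x ← xs ] (2 ^ f x + 2 ^ b * b)
    ≡⟨ ∑-distrib-+ xs (λ x → 2 ^ f x) _ ⟩
  ∑2^f + ∑[ _ ← xs ] (2 ^ b * b)   ≡⟨ cong (_+_ ∑2^f) (∑-const xs _) ⟩
  ∑2^f + l * (2 ^ b * b)           ≡⟨ cong (_+_ ∑2^f) (swap l (2 ^ b) b) ⟩
  ∑2^f + 2 ^ b * (l * b)           ∎)
  where
  open ≤-Reasoning
  l = length xs
  ∑2^f = ∑[ x ← xs ] (2 ^ f x)
  swap : ∀ l t b → l * (t * b) ≡ t * (l * b)
  swap = solve-∀

-- The lower bound for INDEX with shared randomness.

length-allFin : ∀ n → length (allFin n) ≡ n
length-allFin n = length-tabulate {n = n} (λ i → i)

-- The double sum of `2 ^ agreeω ω x` is bounded below string by string, through convexity over the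
-- seeds, and above seed by seed, through counting messages. The length is written `10 * m` so that
-- nine tenths of it is the integer `9 * m`.
index-lower-bound :
  ∀ {S s m} .⦃ _ : NonZero S ⦄
  (message : Fin S → Vec Bool (10 * m) → Vec Bool s)
  (decode : Fin S → Vec Bool s → Fin (10 * m) → Bool) →
  (∀ x i → 9 * S ≤ 10 * ∑[ ω ← allFin S ] ind (decode ω (message ω x) i Bool.≟ lookup x i)) →
  3 * m ≤ s
index-lower-bound {S} {s} {m} message decode correct =
  ≮⇒≥ λ s<3m → <⇒≱ (^-monoʳ-< 2 (s≤s (s≤s z≤n)) s<3m) 2^3m≤2^s
  where
  open ≤-Reasoning
  N = 10 * m
  seeds = allFin S

  agreeω : Fin S → Vec Bool N → ℕ
  agreeω ω x = agree x (decode ω (message ω x))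

  mean-agree : ∀ x → length seeds * (9 * m) ≤ ∑[ ω ← seeds ] agreeω ω x
  mean-agree x = *-cancelˡ-≤ 10 (begin
    10 * (length seeds * (9 * m)) ≡⟨ cong (λ c → 10 * (c * (9 * m))) (length-allFin S) ⟩
    10 * (S * (9 * m))            ≡⟨ regroup S m ⟩
    N * (9 * S)                   ≡⟨ cong (_* (9 * S)) (length-allFin N) ⟨
    length (allFin N) * (9 * S)   ≡⟨ ∑-const (allFin N) (9 * S) ⟨
    ∑[ i ← allFin N ] (9 * S)     ≤⟨ ∑-mono-≤ (allFin N) (correct x) ⟩
    ∑[ i ← allFin N ] (10 * ∑[ ω ← seeds ] ind (decode ω (message ω x) i Bool.≟ lookup x i))
      ≡⟨ *-distribˡ-∑ (allFin N) 10 _ ⟨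
    10 * ∑[ i ← allFin N ] ∑[ ω ← seeds ] ind (decode ω (message ω x) i Bool.≟ lookup x i)
      ≡⟨ cong (10 *_) (∑-comm (allFin N) seeds (λ i ω → ind (decode ω (message ω x) i Bool.≟ lookup x i))) ⟩
    10 * ∑[ ω ← seeds ] agreeω ω x ∎)
    where
    regroup : ∀ S m → 10 * (S * (9 * m)) ≡ 10 * m * (9 * S)
    regroup = solve-∀

  seed-sum : ∀ ω → ∑[ x ← cube N ] (2 ^ agreeω ω x) ≤ 2 ^ s * 3 ^ N
  seed-sum ω = begin
    ∑[ x ← cube N ] (2 ^ agree x (decode ω (message ω x)))
      -- The message actually sent is one of the terms `μ`. Once `μ` ranges independently of `x`,
      -- the decoded string is fixed and `∑-2^agree` applies.
      ≤⟨ ∑-mono-≤ (cube N) (λ x → ∈⇒≤∑ (λ μ → 2 ^ agree x (decode ω μ)) (∈-cube (message ω x))) ⟩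
    ∑[ x ← cube N ] ∑[ μ ← cube s ] (2 ^ agree x (decode ω μ))
      ≡⟨ ∑-comm (cube N) (cube s) (λ x μ → 2 ^ agree x (decode ω μ)) ⟩
    ∑[ μ ← cube s ] ∑[ x ← cube N ] (2 ^ agree x (decode ω μ))
      ≡⟨ ∑-cong (cube s) (λ μ → ∑-2^agree (decode ω μ)) ⟩
    ∑[ μ ← cube s ] (3 ^ N)
      ≡⟨ ∑-const (cube s) _ ⟩
    length (cube s) * 3 ^ N
      ≡⟨ cong (_* 3 ^ N) (length-cube s) ⟩
    2 ^ s * 3 ^ N ∎

  count : S * (2 ^ N * 2 ^ (9 * m)) ≤ S * (2 ^ s * 3 ^ N)
  count = begin
    S * (2 ^ N * 2 ^ (9 * m)) ≡⟨ swap S (2 ^ N) (2 ^ (9 * m)) ⟩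
    2 ^ N * (S * 2 ^ (9 * m)) ≡⟨ cong₂ (λ c l → c * (l * 2 ^ (9 * m))) (length-cube N) (length-allFin S) ⟨
    length (cube N) * (length seeds * 2 ^ (9 * m)) ≡⟨ ∑-const (cube N) _ ⟨
    ∑[ x ← cube N ] (length seeds * 2 ^ (9 * m)) ≤⟨ ∑-mono-≤ (cube N) (λ x → jensen-2^ seeds _ _ (mean-agree x)) ⟩
    ∑[ x ← cube N ] ∑[ ω ← seeds ] (2 ^ agreeω ω x) ≡⟨ ∑-comm (cube N) seeds (λ x ω → 2 ^ agreeω ω x) ⟩
    ∑[ ω ← seeds ] ∑[ x ← cube N ] (2 ^ agreeω ω x) ≤⟨ ∑-mono-≤ seeds seed-sum ⟩
    ∑[ ω ← seeds ] (2 ^ s * 3 ^ N) ≡⟨ ∑-const seeds _ ⟩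
    length seeds * (2 ^ s * 3 ^ N) ≡⟨ cong (_* (2 ^ s * 3 ^ N)) (length-allFin S) ⟩
    S * (2 ^ s * 3 ^ N) ∎
    where
    swap : ∀ S c t → S * (c * t) ≡ c * (S * t)
    swap = solve-∀

  2^3m≤2^s : 2 ^ (3 * m) ≤ 2 ^ s
  -- The factor `2 ^ (16 * m)` is an upper bound for `3 ^ N`, since 3^10 = 59049 and 2^16 = 65536;
  -- the exponents then balance as 3 + 16 = 10 + 9.
  2^3m≤2^s = *-cancelʳ-≤ _ _ (2 ^ (16 * m)) ⦃ m^n≢0 2 (16 * m) ⦄ (begin
    2 ^ (3 * m) * 2 ^ (16 * m) ≡⟨ ^-distribˡ-+-* 2 (3 * m) (16 * m) ⟨
    2 ^ (3 * m + 16 * m)       ≡⟨ cong (2 ^_) (regroup m) ⟩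
    2 ^ (10 * m + 9 * m)       ≡⟨ ^-distribˡ-+-* 2 (10 * m) (9 * m) ⟩
    2 ^ N * 2 ^ (9 * m)        ≤⟨ *-cancelˡ-≤ S count ⟩
    2 ^ s * 3 ^ N              ≡⟨ cong (2 ^ s *_) (^-*-assoc 3 10 m) ⟨
    2 ^ s * (3 ^ 10) ^ m       ≤⟨ *-monoʳ-≤ (2 ^ s) (^-monoˡ-≤ m (≤ᵇ⇒≤ (3 ^ 10) (2 ^ 16) _)) ⟩
    2 ^ s * (2 ^ 16) ^ m       ≡⟨ cong (2 ^ s *_) (^-*-assoc 2 16 m) ⟩
    2 ^ s * 2 ^ (16 * m)       ∎)
    where
    regroup : ∀ m → 3 * m + 16 * m ≡ 10 * m + 9 * m
    regroup = solve-∀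

-- Pairs of nodes and clusterings without disagreement.

_≟ᵖ_ : (e e′ : Pair n) → Dec (e ≡ e′)
pair u v _ ≟ᵖ pair u′ v′ _ =
  map′ (λ { (refl , refl) → refl }) (λ { refl → refl , refl }) (u Fin.≟ u′ ×-dec v Fin.≟ v′)

endpoints-≢ : ∀ (e : Pair n) → Pair.u e ≢ Pair.v e
endpoints-≢ (pair u v u<v) u≡v = contradiction-irr u<v (Fin.<-irrefl u≡v)

-- Both listings are increasing, so the ends can be neither matched crosswise nor sent to a single
-- node. This singles out the queried slot as the only one with both ends in the merged cluster.
same-endpoints : ∀ (e e′ : Pair n) →
  Pair.u e ≡ Pair.u e′ ⊎ Pair.u e ≡ Pair.v e′ → Pair.v e ≡ Pair.u e′ ⊎ Pair.v e ≡ Pair.v e′ → e ≡ e′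
same-endpoints (pair _ _ _)   (pair _ _ _)   (inj₁ refl) (inj₂ refl) = refl
same-endpoints (pair _ _ u<v) (pair _ _ _)   (inj₁ refl) (inj₁ refl) = contradiction-irr u<v (Fin.<-irrefl refl)
same-endpoints (pair _ _ u<v) (pair _ _ _)   (inj₂ refl) (inj₂ refl) = contradiction-irr u<v (Fin.<-irrefl refl)
same-endpoints (pair _ _ u<v) (pair _ _ v<u) (inj₂ refl) (inj₁ refl) =
  contradiction-irr (Fin.<-trans u<v v<u) (Fin.<-irrefl refl)

∈-allPairs : ∀ (e : Pair n) → e ∈ allPairs n
∈-allPairs {n} (pair u v u<v) = Any.mapMaybe⁺ _ _
  (lose (∈-map⁺ _ (∈-cartesianProduct⁺ (∈-allFin u) (∈-allFin v))) increasing-uv)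
  where
  increasing-uv : MAny.Any (pair u v u<v ≡_) (Maybe.map (λ p → pair u v p) (dec⇒maybe (u Fin.<? v)))
  increasing-uv with u Fin.<? v
  ... | yes _ = MAny.just refl
  ... | no u≮v = contradiction-irr u<v u≮v

module _ (G : WeightedGraph n) (C : Clustering n) where

  disagrees⇒1≤weight : ∀ e → Disagrees G C e → 1 ≤ ∣ ⟦ G e ⟧ ∣
  disagrees⇒1≤weight e d with G e | d
  ... | -1ʷ | _ = s≤s z≤n
  ... | +1ʷ | _ = s≤s z≤n
  ... | 0ʷ  | inj₁ (+<+ () , _)
  ... | 0ʷ  | inj₂ (+<+ () , _)

  -- A disagreeing pair has nonzero weight and occurs in `allPairs n`, so it alone makes the sum
  -- positive.
  disagree≡0⇔ : disagree G C ≡ 0 ⇔ (∀ e → ¬ Disagrees G C e)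
  disagree≡0⇔ = mk⇔
    (λ none e d → <⇒≱ (disagrees⇒1≤weight e d)
      (≤-trans
        (∈⇒≤∑ (λ e → ∣ ⟦ G e ⟧ ∣) (∈-filter⁺ (disagrees? G C) (∈-allPairs e) d))
        (≤-reflexive none)))
    (λ none → cong (sum ∘ map _) (filter-none (disagrees? G C) (All.universal none (allPairs n))))

-- The graph described by a stream.

graphOf : Stream n → WeightedGraph n
graphOf []            e = 0ʷ
graphOf ((e′ , w) ∷ σ) e with e ≟ᵖ e′
... | yes _ = w
... | no  _ = graphOf σ e

-- `graphOf` returns the first weight listed for a pair. Distinctness of the pairs, which is
-- stronger than distinctness of the tokens, ensures that no earlier token shadows the given one.
graphOf-∈ : ∀ {σ : Stream n} → Unique (map proj₁ σ) → All ((_≢ 0ʷ) ∘ proj₂) σ →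
            ∀ {e w} → (e , w) ∈ σ → graphOf σ e ≡ w × w ≢ 0ʷ
graphOf-∈ {σ = (e′ , w′) ∷ σ} (_ ∷ _) (w′≢0 ∷ _) {e} (here refl) with e ≟ᵖ e
... | yes _  = refl , w′≢0
... | no e≢e = contradiction refl e≢e
graphOf-∈ {σ = (e′ , w′) ∷ σ} (e′∉ ∷ !σ) (_ ∷ ≢0) {e} (there e∈σ) with e ≟ᵖ e′
... | yes refl = contradiction refl (All.lookup e′∉ (∈-map⁺ proj₁ e∈σ))
... | no _     = graphOf-∈ !σ ≢0 e∈σ

∈-graphOf : ∀ (σ : Stream n) e → graphOf σ e ≢ 0ʷ → (e , graphOf σ e) ∈ σ
∈-graphOf []             e ≢0 = contradiction refl ≢0
∈-graphOf ((e′ , w) ∷ σ) e ≢0 with e ≟ᵖ e′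
... | yes refl = here refl
... | no _     = there (∈-graphOf σ e ≢0)

isStreamOf-graphOf : ∀ (σ : Stream n) →
                     Unique (map proj₁ σ) → All ((_≢ 0ʷ) ∘ proj₂) σ → σ IsStreamOf graphOf σ
isStreamOf-graphOf σ !σ ≢0 = Unique.map⁻ !σ , λ e w →
  mk⇔ (graphOf-∈ !σ ≢0) λ { (refl , w≢0) → ∈-graphOf σ e w≢0 }

clusteringBy : (Fin n → Fin n) → Clustering n
clusteringBy label = record
  { _~_ = λ u v → label u ≡ label v
  ; isDecEquivalence = On.isDecEquivalence label (≡.isDecEquivalence Fin._≟_)
  }

-- The reduction from INDEX to disagreement-free clustering.

module IndexReduction {n N} (slot : Fin N → Pair n) (slot-injective : Injective _≡_ _≡_ slot) where

  -- Node zero is the hub.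
  shift : Pair n → Pair (suc n)
  shift (pair u v u<v) = pair (suc u) (suc v) (s<s u<v)

  shift-injective : ∀ {e e′} → shift e ≡ shift e′ → e ≡ e′
  shift-injective {pair _ _ _} {pair _ _ _} refl = refl

  spoke : Fin n → Pair (suc n)
  spoke u = pair zero (suc u) z<s

  negative : Fin N → Token (suc n)
  negative j = shift (slot j) , -1ʷ

  alice : Vec Bool N → Stream (suc n)
  alice x = map negative (filter (λ j → lookup x j Bool.≟ false) (allFin N))

  bob : Fin N → Stream (suc n)
  bob i = (spoke (Pair.u (slot i)) , +1ʷ) ∷ (spoke (Pair.v (slot i)) , +1ʷ) ∷ []

  ∈-alice⁺ : ∀ x j → lookup x j ≡ false → negative j ∈ alice x
  ∈-alice⁺ x j xj = ∈-map⁺ negative (∈-filter⁺ _ (∈-allFin j) xj)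

  ∈-alice⁻ : ∀ x {t} → t ∈ alice x → ∃[ j ] (lookup x j ≡ false × t ≡ negative j)
  ∈-alice⁻ x t∈ with ∈-map⁻ negative t∈
  ... | j , j∈ , eq = j , proj₂ (∈-filter⁻ _ {xs = allFin N} j∈) , eq

  module _ (x : Vec Bool N) (i : Fin N) where

    stream : Stream (suc n)
    stream = alice x ++ bob i

    graph : WeightedGraph (suc n)
    graph = graphOf stream

    u v : Fin n
    u = Pair.u (slot i)
    v = Pair.v (slot i)

    unique-keys : Unique (map proj₁ stream)
    unique-keys = subst Unique (sym (map-++ proj₁ (alice x) (bob i)))
      (Unique.++⁺
        (subst Unique (map-∘ _)
          (Unique.map⁺ (slot-injective ∘ shift-injective) (Unique.filter⁺ _ (Unique.allFin⁺ N))))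
        ((endpoints-≢ (slot i) ∘ Fin.suc-injective ∘ cong Pair.v ∷ []) ∷ [] ∷ [])
        disjoint)
      where
      -- Spokes contain the hub `zero`, whereas shifted slots avoid it.
      disjoint : ∀ {e} → ¬ (e ∈ map proj₁ (alice x) × e ∈ map proj₁ (bob i))
      disjoint (e∈alice , e∈bob) with ∈-map⁻ proj₁ e∈alice
      ... | _ , t∈ , refl with ∈-alice⁻ x t∈
      disjoint (_ , here ())          | _ , _ , refl | _ , _ , refl
      disjoint (_ , there (here ()))  | _ , _ , refl | _ , _ , refl

    nonzero-weights : All ((_≢ 0ʷ) ∘ proj₂) stream
    nonzero-weights = All.++⁺ (All.map⁺ (All.universal (λ _ ()) _)) ((λ ()) ∷ (λ ()) ∷ [])

    isStream : stream IsStreamOf graph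
    isStream = isStreamOf-graphOf stream unique-keys nonzero-weights

    weight : ∀ {e w} → (e , w) ∈ stream → graph e ≡ w
    weight = proj₁ ∘ graphOf-∈ unique-keys nonzero-weights

    positive-edge : ∀ e → 0ℤ ℤ.< ⟦ graph e ⟧ → e ≡ spoke u ⊎ e ≡ spoke v
    positive-edge e 0<w with graph e in eq
    ... | +1ʷ with ∈-++⁻ (alice x)
                 (subst (λ w → (e , w) ∈ stream) eq (∈-graphOf stream e (subst (_≢ 0ʷ) (sym eq) λ ())))
    ...   | inj₁ e∈alice with () ← proj₂ (proj₂ (∈-alice⁻ x e∈alice))
    ...   | inj₂ (here refl)         = inj₁ refl
    ...   | inj₂ (there (here refl)) = inj₂ refl
    positive-edge e (+<+ ()) | 0ʷ

    negative-edge : ∀ e → ⟦ graph e ⟧ ℤ.< 0ℤ → ∃[ j ] (lookup x j ≡ false × e ≡ shift (slot j))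
    negative-edge e w<0 with graph e in eq
    ... | -1ʷ with ∈-++⁻ (alice x)
                 (subst (λ w → (e , w) ∈ stream) eq (∈-graphOf stream e (subst (_≢ 0ʷ) (sym eq) λ ())))
    ...   | inj₁ e∈alice with j , xj , refl ← ∈-alice⁻ x e∈alice = j , xj , refl
    ...   | inj₂ (here ())
    ...   | inj₂ (there (here ()))
    negative-edge e (+<+ ()) | 0ʷ
    negative-edge e (+<+ ()) | +1ʷ

    merged? : ∀ a → Dec (a ≡ u ⊎ a ≡ v)
    merged? a = a Fin.≟ u ⊎-dec a Fin.≟ v

    label : Fin (suc n) → Fin (suc n)
    label zero    = zero
    label (suc a) with merged? a
    ... | yes _ = zero
    ... | no  _ = suc a

    label-merged : ∀ {a} → a ≡ u ⊎ a ≡ v → label (suc a) ≡ zero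
    label-merged {a} a∈ with merged? a
    ... | yes _  = refl
    ... | no  a∉ = contradiction a∈ a∉

    -- An unmerged node keeps its own nonzero label, so it shares a label neither with a merged node
    -- nor with another unmerged one.
    label-≡ : ∀ {a b} → label (suc a) ≡ label (suc b) → a ≡ b ⊎ ((a ≡ u ⊎ a ≡ v) × (b ≡ u ⊎ b ≡ v))
    label-≡ {a} {b} eq with merged? a | merged? b
    ... | yes a∈ | yes b∈ = inj₂ (a∈ , b∈)
    ... | no  _  | no  _  = inj₁ (Fin.suc-injective eq)

    -- Both spokes lie in the cluster labelled `zero`. A negative edge inside a cluster would have
    -- both ends among `u` and `v`, hence be slot `i` itself, whose bit would then be `false`.
    true⇒min≡0 : lookup x i ≡ true → MinDisagreeIs graph 0
    true⇒min≡0 xi = (C , Equivalence.from (disagree≡0⇔ graph C) no-disagreement) , λ _ → z≤n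
      where
      C = clusteringBy label
      no-disagreement : ∀ e → ¬ Disagrees graph C e
      no-disagreement e (inj₁ (0<w , e≁)) with positive-edge e 0<w
      ... | inj₁ refl = e≁ (sym (label-merged (inj₁ refl)))
      ... | inj₂ refl = e≁ (sym (label-merged (inj₂ refl)))
      no-disagreement e (inj₂ (w<0 , e~)) with negative-edge e w<0
      ... | j , xj , refl with label-≡ e~
      ...   | inj₁ u≡v      = endpoints-≢ (slot j) u≡v
      ...   | inj₂ (a∈ , b∈) with slot-injective (same-endpoints (slot j) (slot i) a∈ b∈)
      ...     | refl with () ← trans (sym xi) xj

    -- Agreement on the two spokes joins `u` and `v` through the hub, against the negative edge that
    -- the `false` bit puts between them.
    false⇒min≢0 : lookup x i ≡ false → ¬ MinDisagreeIs graph 0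
    false⇒min≢0 xi ((C , C≡0) , _) = agreement (shift (slot i)) (inj₂
      ( subst (λ w → ⟦ w ⟧ ℤ.< 0ℤ) (sym (weight (∈-++⁺ˡ (∈-alice⁺ x i xi)))) -<+
      , ~.trans (~.sym (together (here refl))) (together (there (here refl)))))
      where
      open Clustering C
      module ~ = IsDecEquivalence isDecEquivalence
      agreement = Equivalence.to (disagree≡0⇔ graph C) C≡0
      together : ∀ {a} → (spoke a , +1ʷ) ∈ bob i → zero ~ suc a
      -- Agreement on a positive edge only refutes separation; decidability of the cluster relation
      -- turns this into membership of the same cluster.
      together {a} e∈ = decidable-stable (zero ~? suc a) λ ≁ → agreement (spoke a) (inj₁
        (subst (λ w → 0ℤ ℤ.< ⟦ w ⟧) (sym (weight (∈-++⁺ʳ (alice x) e∈)))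
          (+<+ z<s) , ≁))

-- Slots from a complete bipartite grid.

module _ {n} a b (a+b≤n : a + b ≤ n) where

  row : Fin a → Fin n
  row i = inject≤ (i ↑ˡ b) a+b≤n

  column : Fin b → Fin n
  column j = inject≤ (a ↑ʳ j) a+b≤n

  -- Rows take the first `a` nodes and columns the next `b`, so a grid pair is already in the
  -- increasing order that `Pair` demands.
  row<column : ∀ i j → row i Fin.< column j
  row<column i j = begin-strict
    toℕ (row i)    ≡⟨ Fin.toℕ-inject≤ (i ↑ˡ b) a+b≤n ⟩
    toℕ (i ↑ˡ b)   ≡⟨ Fin.toℕ-↑ˡ i b ⟩
    toℕ i          <⟨ Fin.toℕ<n i ⟩
    a              ≤⟨ m≤m+n a (toℕ j) ⟩
    a + toℕ j      ≡⟨ Fin.toℕ-↑ʳ a j ⟨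
    toℕ (a ↑ʳ j)   ≡⟨ Fin.toℕ-inject≤ (a ↑ʳ j) a+b≤n ⟨
    toℕ (column j) ∎
    where open ≤-Reasoning

  bipartite : Fin (a * b) → Pair n
  bipartite k = let i , j = remQuot {a} b k in pair (row i) (column j) (row<column i j)

  bipartite-injective : Injective _≡_ _≡_ bipartite
  bipartite-injective {k} {l} eq = begin
    k                             ≡⟨ Fin.combine-remQuot {a} b k ⟨
    uncurry combine (remQuot {a} b k) ≡⟨ cong₂ combine
      (Fin.↑ˡ-injective b _ _ (Fin.inject≤-injective a+b≤n a+b≤n _ _ (cong Pair.u eq)))
      (Fin.↑ʳ-injective a _ _ (Fin.inject≤-injective a+b≤n a+b≤n _ _ (cong Pair.v eq))) ⟩
    uncurry combine (remQuot {a} b l) ≡⟨ Fin.combine-remQuot {a} b l ⟩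
    l                             ∎
    where open ≡-Reasoning

-- From a stream algorithm to an INDEX protocol.

9/10≤⇒9*≤10* : ∀ k d .⦃ _ : NonZero d ⦄ → + 9 / 10 ≤ᵘ + k / d → 9 * d ≤ 10 * k
9/10≤⇒9*≤10* k d@(suc _) p = subst (9 * d ≤_) (*-comm k 10)
  (ℤ.drop‿+≤+ (subst₂ ℤ._≤_ (sym (ℤ.pos-* 9 d)) (sym (ℤ.pos-* k 10)) (drop-*≤* p)))

module _ {n m s} (slot : Fin (10 * m) → Pair n) (slot-injective : Injective _≡_ _≡_ slot)
         (A : StreamAlgorithm (suc n) s) (tests : TestsMinDisagreeZero A) where

  open StreamAlgorithm A
  open IndexReduction slot slot-injective

  message : Fin seeds → Vec Bool (10 * m) → Memory
  message ω x = foldl (step ω) (init ω) (alice x)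

  decode : Fin seeds → Memory → Fin (10 * m) → Bool
  decode ω μ i = output ω (foldl (step ω) μ (bob i))

  -- A run on `alice x ++ bob i` passes through the memory left by `alice x`, so with the same seed
  -- it gives exactly the decoded bit, and the guarantee of `tests` carries over.
  decode-correct : ∀ x i →
                   9 * seeds ≤ 10 * ∑[ ω ← allFin seeds ] ind (decode ω (message ω x) i Bool.≟ lookup x i)
  decode-correct x i = subst (λ k → 9 * seeds ≤ 10 * k) runs≡decodes
    (9/10≤⇒9*≤10* _ seeds (run-correct (lookup x i) refl))
    where
    τ = stream x i
    -- The separate `b` allows a case split on the bit while `xi` keeps its value available.
    run-correct : ∀ b → lookup x i ≡ b → + 9 / 10 ≤ᵘ Pr[run τ ≡ lookup x i ]
    run-correct b xi with tests _ τ (isStream x i)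
    run-correct true  xi | yes≥ , _ rewrite xi = yes≥ (true⇒min≡0 x i xi)
    run-correct false xi | _ , no≥ rewrite xi = no≥ (false⇒min≢0 x i xi)
    runs≡decodes : length (filter (λ ω → run ω τ Bool.≟ lookup x i) (allFin seeds))
                 ≡ ∑[ ω ← allFin seeds ] ind (decode ω (message ω x) i Bool.≟ lookup x i)
    runs≡decodes = trans (length-filter-∑ _ (allFin seeds)) (∑-cong (allFin seeds) λ ω →
      cong (λ μ → ind (output ω μ Bool.≟ lookup x i))
        (foldl-++ (step ω) (init ω) (alice x) (bob i)))

  slots-lower-bound : 3 * m ≤ s
  slots-lower-bound = index-lower-bound {m = m} message decode decode-correct

-- With h = ⌊n/12⌋ there is room for a hub and a 10h × h bipartite grid of slots.
quadratic-lower-bound : ∀ n → 12 ≤ n → ∀ {s} (A : StreamAlgorithm n s) →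
                        TestsMinDisagreeZero A → n ^ 2 ≤ 192 * s
quadratic-lower-bound n@(suc n-1) 12≤n {s} A tests = begin
  n ^ 2                 ≡⟨ cong (n *_) (*-identityʳ n) ⟩
  n * n                 ≤⟨ *-mono-≤ n≤24h n≤24h ⟩
  (24 * h) * (24 * h)   ≡⟨ regroup h ⟩
  192 * (3 * (h * h))   ≤⟨ *-monoʳ-≤ 192 (slots-lower-bound {m = h * h} (proj₁ slots) (proj₂ slots) A tests) ⟩
  192 * s               ∎
  where
  open ≤-Reasoning
  h = n ℕ./ 12
  1≤h : 1 ≤ h
  1≤h = m≥n⇒m/n>0 12≤n
  regroup : ∀ h → (24 * h) * (24 * h) ≡ 192 * (3 * (h * h))
  regroup = solve-∀
  -- Rounding down loses less than 12, which one further `h * 12` covers because `h` is positive.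
  n≤24h : n ≤ 24 * h
  n≤24h = begin
    n                 ≡⟨ m≡m%n+[m/n]*n n 12 ⟩
    n ℕ.% 12 + h * 12   ≤⟨ +-monoˡ-≤ (h * 12) (<⇒≤ (m%n<n n 12)) ⟩
    12 + h * 12       ≤⟨ +-monoˡ-≤ (h * 12) (*-monoˡ-≤ 12 1≤h) ⟩
    h * 12 + h * 12   ≡⟨ double h ⟩
    24 * h            ∎
    where
    double : ∀ h → h * 12 + h * 12 ≡ 24 * h
    double = solve-∀
  -- The inequality is strict because the hub takes one node and the grid must fit into the other
  -- `n-1`.
  11h<n : 10 * h + h < n
  11h<n = begin-strict
    10 * h + h       ≡⟨ +-identityʳ _ ⟨
    10 * h + h + 0   <⟨ +-monoʳ-< (10 * h + h) 1≤h ⟩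
    10 * h + h + h   ≡⟨ twelve h ⟩
    h * 12           ≤⟨ m/n*n≤m n 12 ⟩
    n                ∎
    where
    twelve : ∀ h → 10 * h + h + h ≡ h * 12
    twelve = solve-∀
  slots : ∃[ slot ] Injective {A = Fin (10 * (h * h))} {B = Pair n-1} _≡_ _≡_ slot
  slots = subst (λ N → ∃[ slot ] Injective {A = Fin N} {B = Pair n-1} _≡_ _≡_ slot) (*-assoc 10 h h)
    (bipartite (10 * h) h (s≤s⁻¹ 11h<n) , bipartite-injective (10 * h) h (s≤s⁻¹ 11h<n))

theorem30 : ∃[ c ] ∃[ n₀ ] (0ℚᵘ <ᵘ c ×
    (∀ (n : ℕ) → n₀ ≤ n → ∀ (space : ℕ) (A : StreamAlgorithm n space) →
    TestsMinDisagreeZero A → c *ᵘ (+ (n ^ 2) / 1) ≤ᵘ (+ space / 1)))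
-- Combining `n ≤ 24 * h` with `3 * (h * h) ≤ space` gives 192 = 24^2 / 3, and 12 is the least `n`
-- for which `h` is positive.
theorem30 = + 1 / 192 , 12 , *<* (+<+ z<s) , λ n 12≤n space A tests →
  *≤* (subst₂ ℤ._≤_ (trans (sym (ℤ.*-identityˡ _)) (sym (ℤ.*-identityʳ _))) (ℤ.pos-* space 192)
    (+≤+ (subst (n ^ 2 ≤_) (*-comm 192 space) (quadratic-lower-bound n 12≤n A tests))))
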